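{- Let $G$ be a $(k+1)$-critical hypergraph with $k\ge2$, and let $F\subseteq E(G)$ be a separating edge set of $G$ with $|F|\le k$. Then $|F|=k$ and there is an edge cut $(X,Y,F)$ of $G$ with the following properties: (a) every $k$-coloring $\varphi$ of $G[X]$ satisfies $|\varphi(X_F)|=1$, and every $k$-coloring $\varphi$ of $G[Y]$ satisfies $|\varphi(Y_F)|=k$ and, for every color $i\in\{1,\dots,k\}$, there is an edge $e\in F$ with $\varphi(e\cap Y)=\{i\}$; (b) each vertex of $Y_F$ is incident to exactly one edge of $F$; (c) if $|X_F|\ge2$, then the hypergraph obtained from $G[X]$ by adding the edge $X_F$ is $(k+1)$-critical; (d) the hypergraph obtained from $G[Y]$ by adding a new vertex $v$ and, for each edge $e\in F$, the new edge $(e\setminus X)\cup\{v\}$, is $(k+1)$-critical.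
   Context: A hypergraph is a pair $G=(V,E)$ of finite sets with $E\subseteq 2^V$ and $|e|\ge2$ for all $e\in E$. A $k$-coloring is a map $V\to\{1,\dots,k\}$ such that every edge contains two vertices of different colors; $\chi$ is the chromatic number. $G$ is $(k+1)$-critical if $\chi(G)=k+1$ but $\chi(H)\le k$ for every proper subhypergraph $H$. $G[X]$ has vertex set $X$ and the edges of $G$ contained in $X$. For $X\subseteq V(G)$, $\partial_G(X)$ is the set of edges meeting both $X$ and $V(G)\setminus X$. A separating edge set is a set $F\subseteq E(G)$ such that $G-F$ has more (connected) components than $G$. An edge cut of $G$ is a triple $(X,Y,F)$ with $X$ a non-empty proper subset of $V(G)$, $Y=V(G)\setminus X$, and $F=\partial_G(X)$; then $X_F$ (resp. $Y_F$) denotes the set of vertices of $X$ (resp. $Y$) incident to some edge of $F$. -}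

module Defs where

open import Data.Bool.Properties as Bool using ()
open import Data.Fin using (Fin)
open import Data.Fin.Properties as Fin using ()
open import Data.Fin.Subset using
  (Subset; inside; outside; _∈_; _∉_; _⊆_; _⊂_; _∩_; _─_; ⋃; ∣_∣; Nonempty)
open import Data.Fin.Subset.Properties using
  ( _∈?_; _⊆?_; nonempty?; x∈p∩q⁻; p∩q⊆p; x∈p∧x∉q⇒x∈p─q; p─q⊆p
  ; out⊆; in⊆in; x∈p⇒∣p-x∣<∣p∣)
open import Data.Irrelevant using ([_])
open import Data.List using (List; _∷_; _++_; filter; length; map)
import Data.List.Membership.DecPropositional as DecMembership
open import Data.List.Membership.Propositional using () renaming (_∈_ to _∈ₗ_)
open import Data.List.Membership.Propositional.Properties using (∈-filter⁻; ∈-++⁻; ∈-map⁻)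
open import Data.List.Relation.Binary.BagAndSetEquality using (_∼[_]_; set)
open import Data.List.Relation.Binary.Subset.Propositional using () renaming (_⊆_ to _⊆ₗ_)
open import Data.List.Relation.Unary.Any using (here; there)
open import Data.List.Relation.Unary.Unique.Propositional using (Unique)
open import Data.Nat using (ℕ; suc; _≤_; _<_; z≤n; s≤s)
open import Data.Nat.Properties using (≤-trans)
open import Data.Product using (Σ-syntax; ∃-syntax; _×_; _,_; proj₁; proj₂)
open import Data.Refinement using (Refinement-syntax; _,_; value)
open import Data.Sum using (inj₁; inj₂)
import Data.Vec as Vec
import Data.Vec.Properties as Vec
open import Function using (_∘_; _⇔_; Equivalence)
open import Relation.Binary.Construct.Closure.ReflexiveTransitive using (Star)
open import Relation.Binary.Definitions using (DecidableEquality)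
open import Relation.Binary.PropositionalEquality using (_≡_; _≢_; refl; sym; subst)
open import Relation.Nullary using (Dec; yes; no; ¬_; does)
open import Relation.Nullary.Decidable using (¬?; map′; _×-dec_; recompute)

private
  variable
    n k : ℕ

_≟ˢ_ : DecidableEquality (Subset n)
_≟ˢ_ = Vec.≡-dec Bool._≟_

module _ {n : ℕ} where
  open DecMembership (_≟ˢ_ {n}) public using () renaming (_∈?_ to _∈ₗ?_)

-- The vertex set is a subset of an ambient Fin n, so that subhypergraphs of G
-- live over the same n.  The edge set is the set of members of the list E;
-- order and multiplicity in E carry no meaning.
record Hypergraph (n : ℕ) : Set where
  field
    V     : Subset n
    E     : List (Subset n)
    E⊆2^V : ∀ {e} → e ∈ₗ E → e ⊆ V
    2≤∣e∣ : ∀ {e} → e ∈ₗ E → 2 ≤ ∣ e ∣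

open Hypergraph public

Vertex : Hypergraph n → Set
Vertex {n} G = [ v ∈ Fin n ∣ v ∈ V G ]

record Coloring (G : Hypergraph n) (k : ℕ) : Set where
  field
    color  : Vertex G → Fin k
    proper : ∀ {e} → e ∈ₗ E G →
             ∃[ u ] ∃[ w ] value u ∈ e × value w ∈ e × color u ≢ color w

open Coloring public

HasColor : {G : Hypergraph n} → Coloring G k → Subset n → Fin k → Set
HasColor {G = G} φ S i = Σ[ v ∈ Vertex G ] value v ∈ S × color φ v ≡ i

hasColor? : {G : Hypergraph n} (φ : Coloring G k) (S : Subset n) (i : Fin k) →
            Dec (HasColor φ S i)
hasColor? {n = n} {G = G} φ S i =
  map′ (λ { (v , p , r) → (v , [ p ]) , r })
       (λ { ((v , [ p ]) , r) → v , recompute (v ∈? V G) p , r })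
       (Fin.any? at?)
  where
  At : Fin n → Set
  At v = Σ[ p ∈ v ∈ V G ] v ∈ S × color φ (v , [ p ]) ≡ i

  at? : (v : Fin n) → Dec (At v)
  at? v with v ∈? V G
  ... | yes p = map′ (p ,_) proj₂ ((v ∈? S) ×-dec (color φ (v , [ p ]) Fin.≟ i))
  ... | no ¬p = no (¬p ∘ proj₁)

-- The image φ(S ∩ V(G)).
image : {G : Hypergraph n} → Coloring G k → Subset n → Subset k
image φ S = Vec.tabulate (does ∘ hasColor? φ S)

-- χ(G) = m
HasChromaticNumber : Hypergraph n → ℕ → Set
HasChromaticNumber G m = Coloring G m × (∀ {j} → Coloring G j → m ≤ j)

_⊑_ : Hypergraph n → Hypergraph n → Set
H ⊑ G = V H ⊆ V G × E H ⊆ₗ E G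

_⊏_ : Hypergraph n → Hypergraph n → Set
H ⊏ G = H ⊑ G × ¬ (G ⊑ H)

-- For m = suc k the bound χ(H) < m is literally χ(H) ≤ k.
Critical : ℕ → Hypergraph n → Set
Critical m G = HasChromaticNumber G m ×
               (∀ H → H ⊏ G → ∃[ j ] HasChromaticNumber H j × j < m)

-- G[X]
_⟦_⟧ : Hypergraph n → Subset n → Hypergraph n
G ⟦ X ⟧ = record
  { V     = X
  ; E     = filter (_⊆? X) (E G)
  ; E⊆2^V = λ e∈ → proj₂ (∈-filter⁻ (_⊆? X) {xs = E G} e∈)
  ; 2≤∣e∣ = λ e∈ → 2≤∣e∣ G (proj₁ (∈-filter⁻ (_⊆? X) {xs = E G} e∈))
  }

∂ : Hypergraph n → Subset n → List (Subset n)
∂ G X = filter (λ e → nonempty? (e ∩ X) ×-dec nonempty? (e ∩ (V G ─ X))) (E G)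

_-ᴱ_ : Hypergraph n → List (Subset n) → Hypergraph n
G -ᴱ F = record
  { V     = V G
  ; E     = filter ∉F? (E G)
  ; E⊆2^V = λ e∈ → E⊆2^V G (proj₁ (∈-filter⁻ ∉F? {xs = E G} e∈))
  ; 2≤∣e∣ = λ e∈ → 2≤∣e∣ G (proj₁ (∈-filter⁻ ∉F? {xs = E G} e∈))
  }
  where
  ∉F? = λ e → ¬? (e ∈ₗ? F)

Adjacent : Hypergraph n → Fin n → Fin n → Set
Adjacent G u w = ∃[ e ] e ∈ₗ E G × u ∈ e × w ∈ e

-- Vertices joined by a (possibly trivial) walk.
Linked : Hypergraph n → Fin n → Fin n → Set
Linked G = Star (Adjacent G)

-- C is the vertex set of a connected component of G.
IsComponent : Hypergraph n → Subset n → Set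
IsComponent G C = ∃[ v ] v ∈ V G × (∀ u → u ∈ C ⇔ Linked G v u)

HasComponents : Hypergraph n → ℕ → Set
HasComponents G m = ∃[ Cs ] Unique Cs × (∀ C → C ∈ₗ Cs ⇔ IsComponent G C) × length Cs ≡ m

record IsSeparating (G : Hypergraph n) (F : List (Subset n)) : Set where
  field
    F⊆E            : F ⊆ₗ E G
    moreComponents : ∃[ m ] ∃[ m′ ] HasComponents G m × HasComponents (G -ᴱ F) m′ × m < m′

record IsEdgeCut (G : Hypergraph n) (X Y : Subset n) (F : List (Subset n)) : Set where
  field
    X≢∅   : Nonempty X
    X⊂V   : X ⊂ V G
    Y≡V∖X : Y ≡ V G ─ X
    F∼∂X  : F ∼[ set ] ∂ G X

-- X_F, the vertices of X incident to some edge of F.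
ends : Subset n → List (Subset n) → Subset n
ends X F = X ∩ ⋃ F

ends-⊆ : (X : Subset n) (F : List (Subset n)) → ends X F ⊆ X
ends-⊆ X F = p∩q⊆p X (⋃ F)

addEdge : (G : Hypergraph n) (e : Subset n) → e ⊆ V G → 2 ≤ ∣ e ∣ → Hypergraph n
addEdge G e e⊆V 2≤ = record
  { V     = V G
  ; E     = e ∷ E G
  ; E⊆2^V = λ { (here refl) → e⊆V ; (there f∈) → E⊆2^V G f∈ }
  ; 2≤∣e∣ = λ { (here refl) → 2≤ ; (there f∈) → 2≤∣e∣ G f∈ }
  }

private
  x∈p─q⇒x∉q : ∀ {n} {x : Fin n} (p q : Subset n) → x ∈ p ─ q → x ∉ q
  x∈p─q⇒x∉q (_ Vec.∷ p) (inside  Vec.∷ q) (Vec.there x∈) (Vec.there x∈q) = x∈p─q⇒x∉q p q x∈ x∈q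
  x∈p─q⇒x∉q (_ Vec.∷ p) (outside Vec.∷ q) (Vec.there x∈) (Vec.there x∈q) = x∈p─q⇒x∉q p q x∈ x∈q

  x∈p⇒1≤∣p∣ : {x : Fin n} {p : Subset n} → x ∈ p → 1 ≤ ∣ p ∣
  x∈p⇒1≤∣p∣ x∈p = ≤-trans (s≤s z≤n) (x∈p⇒∣p-x∣<∣p∣ x∈p)

-- G[Y] with a new vertex v and the edges (e ∖ X) ∪ {v} for e ∈ F.  The ambient
-- set grows to Fin (suc n): v is zero and an old vertex x becomes suc x.
contract : (G : Hypergraph n) {X Y : Subset n} {F : List (Subset n)} →
           IsEdgeCut G X Y F → Hypergraph (suc n)
contract {n} G {X} {Y} {F} cut = record
  { V     = inside Vec.∷ Y
  ; E     = old ++ new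
  ; E⊆2^V = edge-⊆
  ; 2≤∣e∣ = edge-2≤
  }
  where
  open IsEdgeCut cut

  old new : List (Subset (suc n))
  old = map (outside Vec.∷_) (E (G ⟦ Y ⟧))
  new = map (λ e → inside Vec.∷ (e ─ X)) F

  ∂⁻ : ∀ {e} → e ∈ₗ F → e ∈ₗ E G × Nonempty (e ∩ X) × Nonempty (e ∩ (V G ─ X))
  ∂⁻ e∈F = ∈-filter⁻ _ {xs = E G} (Equivalence.to F∼∂X e∈F)

  edge-⊆ : ∀ {e} → e ∈ₗ old ++ new → e ⊆ inside Vec.∷ Y
  edge-⊆ e∈ with ∈-++⁻ old e∈
  ... | inj₁ e∈old with ∈-map⁻ _ e∈old
  ...   | _ , f∈ , refl = out⊆ (E⊆2^V (G ⟦ Y ⟧) f∈)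
  edge-⊆ e∈ | inj₂ e∈new with ∈-map⁻ _ e∈new
  ...   | f , f∈ , refl = in⊆in λ {x} x∈ → subst (x ∈_) (sym Y≡V∖X)
            (x∈p∧x∉q⇒x∈p─q (E⊆2^V G (proj₁ (∂⁻ f∈)) (p─q⊆p f X x∈)) (x∈p─q⇒x∉q f X x∈))

  edge-2≤ : ∀ {e} → e ∈ₗ old ++ new → 2 ≤ ∣ e ∣
  edge-2≤ e∈ with ∈-++⁻ old e∈
  ... | inj₁ e∈old with ∈-map⁻ _ e∈old
  ...   | _ , f∈ , refl = 2≤∣e∣ (G ⟦ Y ⟧) f∈
  edge-2≤ e∈ | inj₂ e∈new with ∈-map⁻ _ e∈new
  ...   | f , f∈ , refl with ∂⁻ f∈
  ...     | _ , _ , x , x∈ with x∈p∩q⁻ f (V G ─ X) x∈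
  ...       | x∈f , x∈V─X = s≤s (x∈p⇒1≤∣p∣ (x∈p∧x∉q⇒x∈p─q x∈f (x∈p─q⇒x∉q (V G) X x∈V─X)))

{-# OPTIONS --safe #-}

-- A colouring a of G[X] and a colouring b of G[Y] never glue to a colouring of G, whatever permutation σ
-- is applied to b first, so some edge of the cut has colour i on X and j on Y with i = σ j.  The k
-- rotations of σ partition the k × k board of pairs (i , j), so at most k cut edges can do this only if
-- there are exactly k, each permutation being hit exactly once.  Hence any two of these pairs share
-- a row or a column, and all of them form one full row or one full column: a is constant on X_F and
-- b rainbow on the cut edges, or vice versa.  Which of the two happens does not depend on a and b.

module Submission where

open import Defs
open import Data.Empty using (⊥-elim)
open import Data.Fin using (Fin; zero; suc; toℕ; fromℕ<; inject≤; funToFin; finToFun)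
open import Data.Fin.Permutation.Components using (transpose; transpose-inverse)
open import Data.Fin.Properties as Fin using
  ( _≟_; any?; injective⇒≤; toℕ-fromℕ<; toℕ-injective; toℕ<n; inject≤-injective; finToFun-funToFin)
open import Data.Fin.Subset using
  (Subset; inside; outside; _∈_; _∉_; _⊆_; _∩_; _─_; _-_; ⋃; ⊤; ⁅_⁆; ∣_∣; Nonempty)
open import Data.Fin.Subset.Properties using
  ( _∈?_; _⊆?_; nonempty?; Empty-unique; ∣⊥∣≡0; ∣⁅x⁆∣≡1; ∣⊤∣≡n; p⊆q⇒∣p∣≤∣q∣; x∈⁅x⁆; x∈⁅y⁆⇒x≡y
  ; ⊆-antisym; ⊆⊤; ∉⊥; ⊂-irref; x∈p∩q⁺; x∈p∩q⁻; x∈p∪q⁺; x∈p∪q⁻; x∈p∧x≢y⇒x∈p-y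
  ; x∈p∧x∉q⇒x∈p─q; p─q⊆p; p─q─q≡p─q; p∩q≢∅⇒p─q⊂p)
open import Data.Irrelevant using ([_])
open import Data.List using (List; []; _∷_; map; length; lookup)
open import Data.List.Membership.Propositional using (find; lose) renaming (_∈_ to _∈ₗ_)
open import Data.List.Membership.Propositional.Properties using
  (∈-filter⁺; ∈-filter⁻; ∈-++⁺ˡ; ∈-++⁺ʳ; ∈-++⁻; ∈-map⁺; ∈-map⁻; ∈-lookup)
open import Data.List.Relation.Binary.Subset.Propositional using () renaming (_⊆_ to _⊆ₗ_)
import Data.List.Relation.Unary.All as All
open import Data.List.Relation.Unary.All.Properties using (¬All⇒Any¬)
open import Data.List.Relation.Unary.AllPairs using (_∷_)
open import Data.List.Relation.Unary.Any as Any using (here; there; index)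
open import Data.List.Relation.Unary.Any.Properties using (lookup-index)
open import Data.List.Relation.Unary.Unique.Propositional using (Unique)
open import Data.Nat using (ℕ; zero; suc; _≤_; _<_; _+_; _∸_; _^_; _%_; z≤n; s≤s; s≤s⁻¹; NonZero)
open import Data.Nat.DivMod using (_mod_; m%n<n; %-distribˡ-+; [m+n]%n≡m%n; m<n⇒m%n≡m)
open import Data.Nat.Properties using
  (≤-refl; ≤-trans; ≤-antisym; <⇒≤; ≮⇒≥; m≤n⇒m≤1+n; 1+n≰n; +-comm; +-assoc; m∸n+n≡m)
open import Data.Product using (Σ-syntax; ∃-syntax; ∃!; _×_; _,_; proj₁; proj₂; swap)
open import Data.Refinement using (_,_; value)
open import Data.Sum using (_⊎_; inj₁; inj₂; [_,_]′) renaming (swap to ⊎-swap)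
import Data.Vec as Vec
import Data.Vec.Properties as Vec
open import Function using (_∘_; id; case_of_; Injective; Equivalence; _⇔_; mk⇔)
open import Relation.Binary.Construct.Closure.ReflexiveTransitive as Star using (ε; _◅_; _◅◅_)
open import Relation.Binary.PropositionalEquality
  using (_≡_; _≢_; refl; sym; trans; cong; subst; module ≡-Reasoning)
open import Relation.Nullary using (Dec; yes; no; ¬_; does; proof; contradiction)
open import Relation.Nullary.Decidable
  using (map′; _×-dec_; ¬?; decidable-stable; dec-true; dec-false)
open import Relation.Nullary.Negation using (contradiction-irr)
open import Relation.Nullary.Reflects using (Reflects; invert)

-- Separation only says that every edge meeting both `X` and `Y` lies in `F`; a priori the list may
-- contain other edges as well. The count closes this gap: the crossing edges alone block every
-- permutation, so in a list no longer than the number of colours none can be left over. Every entry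
-- crosses, and `F` is exactly the boundary of `X`.
--
-- The conclusions on the two sides are established for all maps that are proper on one side, not
-- just for one chosen pair. This is what gives access to (c) and (d): a colouring of G minus an
-- edge e is still proper on each side that does not contain e, so there it is still constant on X_F
-- or rainbow on Y, respectively.

private
  variable
    n k m j : ℕ

-- Permutation boards

-- A missed value could serve as the image of one more point, giving an injection from `suc k`
-- elements into `m ≤ k`.
injective⇒surjective : {f : Fin k → Fin m} → m ≤ k → Injective _≡_ _≡_ f → ∀ y → ∃[ x ] f x ≡ y
injective⇒surjective {k} {m} {f} m≤k inj y with any? (λ x → f x ≟ y)
... | yes hit = hit
... | no miss = contradiction (≤-trans (injective⇒≤ g-injective) m≤k) 1+n≰n
  where
  g : Fin (suc k) → Fin m
  g zero    = y
  g (suc x) = f x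

  g-injective : Injective _≡_ _≡_ g
  g-injective {zero}  {zero}  _  = refl
  g-injective {zero}  {suc x} eq = contradiction (x , sym eq) miss
  g-injective {suc x} {zero}  eq = contradiction (x , eq) miss
  g-injective {suc x} {suc z} eq = cong suc (inj eq)

-- Adding `d ∸ a` undoes adding `a` modulo `d`; the bound `a ≤ d` keeps the truncated subtraction
-- exact.
+-%-cancelˡ : ∀ {d a x y} .{{_ : NonZero d}} → a ≤ d → (a + x) % d ≡ (a + y) % d → x % d ≡ y % d
+-%-cancelˡ {d} {a} {x} {y} a≤d eq = begin
  x % d                              ≡⟨ unshift x ⟨
  ((d ∸ a) % d + (a + x) % d) % d    ≡⟨ cong (λ r → ((d ∸ a) % d + r) % d) eq ⟩
  ((d ∸ a) % d + (a + y) % d) % d    ≡⟨ unshift y ⟩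
  y % d                              ∎
  where
  open ≡-Reasoning
  unshift : ∀ z → ((d ∸ a) % d + (a + z) % d) % d ≡ z % d
  unshift z = begin
    ((d ∸ a) % d + (a + z) % d) % d  ≡⟨ %-distribˡ-+ (d ∸ a) (a + z) d ⟨
    ((d ∸ a) + (a + z)) % d          ≡⟨ cong (_% d) (+-assoc (d ∸ a) a z) ⟨
    ((d ∸ a) + a + z) % d            ≡⟨ cong (λ s → (s + z) % d) (m∸n+n≡m a≤d) ⟩
    (d + z) % d                      ≡⟨ cong (_% d) (+-comm d z) ⟩
    (z + d) % d                      ≡⟨ [m+n]%n≡m%n z d ⟩
    z % d                            ∎

abstract
  rotate : Fin (suc k) → Fin (suc k) → Fin (suc k)
  rotate {k} c i = (toℕ c + toℕ i) mod suc k

  toℕ-rotate : (c i : Fin (suc k)) → toℕ (rotate c i) ≡ (toℕ c + toℕ i) % suc k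
  toℕ-rotate {k} c i = toℕ-fromℕ< (m%n<n (toℕ c + toℕ i) (suc k))

  rotate-injectiveʳ : (c : Fin (suc k)) → Injective _≡_ _≡_ (rotate c)
  rotate-injectiveʳ {k} c {i} {j} eq = toℕ-injective (begin
    toℕ i          ≡⟨ m<n⇒m%n≡m (toℕ<n i) ⟨
    toℕ i % suc k  ≡⟨ +-%-cancelˡ (<⇒≤ (toℕ<n c))
                        (trans (sym (toℕ-rotate c i)) (trans (cong toℕ eq) (toℕ-rotate c j))) ⟩
    toℕ j % suc k  ≡⟨ m<n⇒m%n≡m (toℕ<n j) ⟩
    toℕ j          ∎)
    where open ≡-Reasoning

  rotate-comm : (c i : Fin (suc k)) → rotate c i ≡ rotate i c
  rotate-comm {k} c i = cong (_mod suc k) (+-comm (toℕ c) (toℕ i))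

  -- The addition table modulo `suc k` is a Latin square. Injectivity in the shift means that
  -- different rotations of one permutation share no cell of the board.
  rotate-injectiveˡ : ∀ {c d} (i : Fin (suc k)) → rotate c i ≡ rotate d i → c ≡ d
  rotate-injectiveˡ {c = c} {d} i eq =
    rotate-injectiveʳ i (trans (rotate-comm i c) (trans eq (rotate-comm d i)))

  rotate-identityˡ : (i : Fin (suc k)) → rotate zero i ≡ i
  rotate-identityˡ i = toℕ-injective (trans (toℕ-rotate zero i) (m<n⇒m%n≡m (toℕ<n i)))

transpose-injective : (i j : Fin k) → Injective _≡_ _≡_ (transpose i j)
transpose-injective i j {x} {y} eq = begin
  x                                  ≡⟨ transpose-inverse j i ⟨
  transpose j i (transpose i j x)    ≡⟨ cong (transpose j i) eq ⟩
  transpose j i (transpose i j y)    ≡⟨ transpose-inverse j i ⟩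
  y                                  ∎
  where open ≡-Reasoning

transpose-first : (i j : Fin k) → transpose i j i ≡ j
transpose-first i j rewrite dec-true (i ≟ i) refl = refl

transpose-other : ∀ {i j x : Fin k} → x ≢ i → x ≢ j → transpose i j x ≡ x
transpose-other {i = i} {j} {x} x≢i x≢j
  rewrite dec-false (x ≟ i) x≢i | dec-false (x ≟ j) x≢j = refl

-- The first transposition sends `j` to `i` and `j′` to `l`; the second corrects `l` to `i′`. It
-- leaves `i` alone, because `i` differs from `l` by injectivity and from `i′` by assumption.
interpolate : ∀ {i i′ j j′ : Fin k} → i ≢ i′ → j ≢ j′ →
              ∃[ σ ] Injective _≡_ _≡_ σ × σ j ≡ i × σ j′ ≡ i′
interpolate {i = i} {i′} {j} {j′} i≢i′ j≢j′ =
  transpose l i′ ∘ transpose j i ,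
  transpose-injective j i ∘ transpose-injective l i′ ,
  trans (cong (transpose l i′) (transpose-first j i)) (transpose-other i≢l i≢i′) ,
  transpose-first l i′
  where
  l = transpose j i j′
  i≢l : i ≢ l
  i≢l eq = j≢j′ (transpose-injective j i (trans (transpose-first j i) eq))

Constant : (Fin m → Fin k) → Set
Constant p = ∀ x y → p x ≡ p y

-- A further `x` with another value of `p` would have to share its value of `q` with both `x₀` and
-- `x₁`. These two would then agree in both coordinates and coincide.
two-equal⇒constant : (p q : Fin m → Fin k) →
                  (∀ x y → p x ≡ p y ⊎ q x ≡ q y) →
                  (∀ {x y} → p x ≡ p y → q x ≡ q y → x ≡ y) →
                  ∀ {x₀ x₁} → x₀ ≢ x₁ → p x₀ ≡ p x₁ → Constant p
two-equal⇒constant p q aligned distinct {x₀} {x₁} x₀≢x₁ p₀≡p₁ x y = trans (const x) (sym (const y))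
  where
  const : ∀ x → p x ≡ p x₀
  const x with aligned x x₀ | aligned x x₁
  ... | inj₁ px≡p₀ | _          = px≡p₀
  ... | inj₂ _     | inj₁ px≡p₁ = trans px≡p₁ (sym p₀≡p₁)
  ... | inj₂ qx≡q₀ | inj₂ qx≡q₁ = contradiction (distinct p₀≡p₁ (trans (sym qx≡q₀) qx≡q₁)) x₀≢x₁

row-or-column : 2 ≤ m → (p q : Fin m → Fin k) →
                (∀ x y → p x ≡ p y ⊎ q x ≡ q y) →
                (∀ {x y} → p x ≡ p y → q x ≡ q y → x ≡ y) →
                (Constant p × Injective _≡_ _≡_ q) ⊎ (Injective _≡_ _≡_ p × Constant q)
row-or-column (s≤s (s≤s _)) p q aligned distinct with aligned zero (suc zero)
... | inj₁ p₀≡p₁ = inj₁ (p-const , λ {x} {y} → distinct (p-const x y))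
  where p-const = two-equal⇒constant p q aligned distinct (λ ()) p₀≡p₁
... | inj₂ q₀≡q₁ = inj₂ ((λ {x} {y} px≡py → distinct px≡py (q-const x y)) , q-const)
  where
  q-const = two-equal⇒constant q p (λ x y → ⊎-swap (aligned x y)) (λ q≡ p≡ → distinct p≡ q≡)
              (λ ()) q₀≡q₁

-- R x i j reads: x occupies row i, column j of the k × k board.
module _ (R : Fin m → Fin (suc k) → Fin (suc k) → Set)
         (R-functional : ∀ {x i j i′ j′} → R x i j → R x i′ j′ → i ≡ i′ × j ≡ j′)
         (m≤k : m ≤ suc k)
         (hits : ∀ σ → Injective _≡_ _≡_ σ → ∃[ x ] ∃[ j ] R x (σ j) j) where

  -- The k rotations of σ partition the board, so k cells meet each of them exactly once.
  private
    module Shifts (σ : Fin (suc k) → Fin (suc k)) (σ-injective : Injective _≡_ _≡_ σ) where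
      hit = λ c → hits (rotate c ∘ σ) (σ-injective ∘ rotate-injectiveʳ c)

      -- An element occupies only one cell, and a cell determines the rotation through it; so
      -- different rotations are hit by different elements.
      hit-injective : Injective _≡_ _≡_ (proj₁ ∘ hit)
      hit-injective {c} {d} eq with hit c | hit d
      hit-injective {c} {d} refl | x , j , r | .x , j′ , r′ with R-functional r r′
      ... | i≡i′ , refl = rotate-injectiveˡ (σ j) i≡i′

      hit-surjective : ∀ x → ∃[ c ] proj₁ (hit c) ≡ x
      hit-surjective = injective⇒surjective m≤k hit-injective

      -- By surjectivity `x` is the hit of some rotation `c`. Its only cell lies on `σ` itself,
      -- which is the rotation by zero, so `c` is `zero`.
      hit-zero : ∀ {x j} → R x (σ j) j → proj₁ (hit zero) ≡ x
      hit-zero {x} {j} r with hit-surjective x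
      ... | c , refl with R-functional r (proj₂ (proj₂ (hit c)))
      ... | i≡ , refl =
        cong (proj₁ ∘ hit) (rotate-injectiveˡ (σ j) (trans (rotate-identityˡ (σ j)) i≡))

  blocking-size : suc k ≤ m
  blocking-size = injective⇒≤ (Shifts.hit-injective id id)

  -- The hits of the rotations of the identity already exhaust all `m` elements. For cut edges this
  -- will mean that each of them crosses and is monochromatic on either side.
  blocking-cell : ∀ x → ∃[ i ] ∃[ j ] R x i j
  blocking-cell x with Shifts.hit-surjective id id x
  ... | c , refl = _ , _ , proj₂ (proj₂ (Shifts.hit id id c))

  blocking-unique : ∀ {x y j j′} σ → Injective _≡_ _≡_ σ → R x (σ j) j → R y (σ j′) j′ → x ≡ y
  blocking-unique σ inj r r′ = trans (sym (Shifts.hit-zero σ inj r)) (Shifts.hit-zero σ inj r′)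

  blocking⇒row-or-column : 2 ≤ suc k →
    ∃[ p ] ∃[ q ] (∀ x → R x (p x) (q x)) ×
      ((Constant p × Injective _≡_ _≡_ q) ⊎ (Injective _≡_ _≡_ p × Constant q))
  blocking⇒row-or-column 2≤k =
    p , q , cell , row-or-column (≤-trans 2≤k blocking-size) p q aligned distinct
    where
    p q : Fin m → Fin (suc k)
    p x = proj₁ (blocking-cell x)
    q x = proj₁ (proj₂ (blocking-cell x))

    cell : ∀ x → R x (p x) (q x)
    cell x = proj₂ (proj₂ (blocking-cell x))

    cell-at : ∀ x {i} → p x ≡ i → R x i (q x)
    cell-at x refl = cell x

    aligned : ∀ x y → p x ≡ p y ⊎ q x ≡ q y
    aligned x y with p x ≟ p y | q x ≟ q y
    ... | yes p≡ | _      = inj₁ p≡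
    ... | no _   | yes q≡ = inj₂ q≡
    ... | no p≢  | no q≢ with interpolate p≢ q≢
    -- Both cells lie on the one permutation `σ`, which is hit only once, so `x ≡ y`.
    ...   | σ , σ-injective , σqx≡px , σqy≡py = inj₁ (cong p
      (blocking-unique {x} {y} σ σ-injective (cell-at x (sym σqx≡px)) (cell-at y (sym σqy≡py))))

    distinct : ∀ {x y} → p x ≡ p y → q x ≡ q y → x ≡ y
    distinct {x} {y} p≡ q≡ = blocking-unique {x} {y} σ (transpose-injective (q x) (p x))
      (cell-at x (sym σqx≡px)) (cell-at y (sym (trans (cong σ (sym q≡)) (trans σqx≡px p≡))))
      where
      σ = transpose (q x) (p x)
      σqx≡px = transpose-first (q x) (p x)

-- Colourings and criticality

-- Colourings are handled as total maps on Fin n, whose values outside the vertex set are junk.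
Split : (Fin n → Fin k) → Subset n → Set
Split c e = ∃[ u ] ∃[ w ] u ∈ e × w ∈ e × c u ≢ c w

Proper : (Fin n → Fin k) → List (Subset n) → Set
Proper c L = ∀ {e} → e ∈ₗ L → Split c e

split? : (c : Fin n → Fin k) (e : Subset n) → Dec (Split c e)
split? c e = any? λ u → any? λ w → (u ∈? e) ×-dec (w ∈? e) ×-dec ¬? (c u ≟ c w)

¬split⇒≡ : ∀ {c : Fin n → Fin k} {e u w} → ¬ Split c e → u ∈ e → w ∈ e → c u ≡ c w
¬split⇒≡ {c = c} {u = u} {w} ¬split u∈e w∈e =
  decidable-stable (c u ≟ c w) λ cu≢cw → ¬split (u , w , u∈e , w∈e , cu≢cw)

proper? : (c : Fin n → Fin k) (L : List (Subset n)) → Dec (Proper c L)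
proper? c L = map′ All.lookup All.tabulate (All.all? (split? c) L)

¬proper⇒∃¬split : ∀ {c : Fin n → Fin k} {L} → ¬ Proper c L → ∃[ e ] e ∈ₗ L × ¬ Split c e
¬proper⇒∃¬split {c = c} {L} ¬proper = find (¬All⇒Any¬ (split? c) L (¬proper ∘ All.lookup))

split-∘ : ∀ {c : Fin n → Fin k} {f : Fin k → Fin j} {e} →
          Injective _≡_ _≡_ f → Split c e → Split (f ∘ c) e
split-∘ inj (u , w , u∈e , w∈e , cu≢cw) = u , w , u∈e , w∈e , cu≢cw ∘ inj

-- Removing `q` a second time changes nothing, whereas it would strictly shrink a difference that
-- still met `q`.
x∈p─q⇒x∉q : ∀ {x} (p : Subset n) {q} → x ∈ p ─ q → x ∉ q
x∈p─q⇒x∉q p {q} x∈p─q x∈q = ⊂-irref (p─q─q≡p─q p q)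
  (p∩q≢∅⇒p─q⊂p (p ─ q) q (_ , x∈p∩q⁺ (x∈p─q , x∈q)))

2≤⇒nonempty : ∀ {e : Subset n} → 2 ≤ ∣ e ∣ → Nonempty e
2≤⇒nonempty {n} {e} 2≤ with nonempty? e
... | yes ne = ne
... | no empty with () ← subst (2 ≤_) (trans (cong ∣_∣ (Empty-unique empty)) (∣⊥∣≡0 n)) 2≤

2≤⇒∃≢ : ∀ {e : Subset n} → 2 ≤ ∣ e ∣ → ∀ u → ∃[ w ] w ∈ e × w ≢ u
2≤⇒∃≢ {e = e} 2≤ u with any? (λ w → (w ∈? e) ×-dec ¬? (w ≟ u))
... | yes found = found
... | no none = contradiction (≤-trans 2≤ (subst (∣ e ∣ ≤_) (∣⁅x⁆∣≡1 u) (p⊆q⇒∣p∣≤∣q∣ e⊆⁅u⁆))) 1+n≰n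
  where
  e⊆⁅u⁆ : e ⊆ ⁅ u ⁆
  e⊆⁅u⁆ {w} w∈e with w ≟ u
  ... | yes refl = x∈⁅x⁆ u
  ... | no w≢u = contradiction (w , w∈e , w≢u) none

total : {G : Hypergraph n} → Coloring G (suc k) → Fin n → Fin (suc k)
total {G = G} φ v with v ∈? V G
... | yes v∈V = color φ (v , [ v∈V ])
... | no _    = zero

total-color : {G : Hypergraph n} (φ : Coloring G (suc k)) (v : Vertex G) →
              total φ (value v) ≡ color φ v
total-color {G = G} φ (v , [ v∈V ]) with v ∈? V G
... | yes _   = refl
... | no v∉V = contradiction-irr v∈V v∉V

total-proper : {G : Hypergraph n} (φ : Coloring G (suc k)) → Proper (total φ) (E G)
total-proper φ e∈ with proper φ e∈
... | u , w , u∈e , w∈e , ≢ = value u , value w , u∈e , w∈e ,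
  λ eq → ≢ (trans (sym (total-color φ u)) (trans eq (total-color φ w)))

fromTotal : (G : Hypergraph n) (c : Fin n → Fin k) → Proper c (E G) → Coloring G k
fromTotal G c c-proper = record
  { color  = c ∘ value
  ; proper = λ e∈ → let u , w , u∈e , w∈e , ≢ = c-proper e∈ in
      (u , [ E⊆2^V G e∈ u∈e ]) , (w , [ E⊆2^V G e∈ w∈e ]) , u∈e , w∈e , ≢
  }

module _ {G : Hypergraph n} (φ : Coloring G (suc k)) where

  ∈-image⁺ : ∀ {S v} → v ∈ V G → v ∈ S → total φ v ∈ image φ S
  ∈-image⁺ {S} {v} v∈V v∈S = Vec.lookup⇒[]= _ _
    (trans (Vec.lookup∘tabulate (does ∘ hasColor? φ S) _)
           (dec-true (hasColor? φ S _) ((v , [ v∈V ]) , v∈S , sym (total-color φ (v , [ v∈V ])))))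

  ∈-image⁻ : ∀ {S i} → i ∈ image φ S → ∃[ v ] v ∈ S × total φ v ≡ i
  ∈-image⁻ {S} {i} i∈ =
    let v , v∈S , eq = invert (subst (Reflects (HasColor φ S i))
                         (trans (sym (Vec.lookup∘tabulate (does ∘ hasColor? φ S) i)) (Vec.[]=⇒lookup i∈))
                         (proof (hasColor? φ S i)))
    in value v , v∈S , trans (total-color φ v) eq

  image-monochromatic : ∀ {S i} → S ⊆ V G → Nonempty S → (∀ {v} → v ∈ S → total φ v ≡ i) →
                        image φ S ≡ ⁅ i ⁆
  image-monochromatic {S} {i} S⊆V (u , u∈S) mono = ⊆-antisym
    (λ j∈ → let v , v∈S , eq = ∈-image⁻ j∈ in
      subst (_∈ ⁅ i ⁆) (trans (sym (mono v∈S)) eq) (x∈⁅x⁆ i))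
    (λ j∈ → subst (_∈ image φ S) (trans (mono u∈S) (sym (x∈⁅y⁆⇒x≡y i j∈)))
              (∈-image⁺ (S⊆V u∈S) u∈S))

  image-full : ∀ {S} → S ⊆ V G → (∀ i → ∃[ v ] v ∈ S × total φ v ≡ i) → image φ S ≡ ⊤
  image-full {S} S⊆V onto = ⊆-antisym ⊆⊤ λ {i} _ → let v , v∈S , eq = onto i in
    subst (_∈ image φ S) eq (∈-image⁺ (S⊆V v∈S) v∈S)

liftColoring : {G : Hypergraph n} → j ≤ k → Coloring G j → Coloring G k
liftColoring {G = G} j≤k φ = record
  { color  = λ v → inject≤ (color φ v) j≤k
  ; proper = λ e∈ → let u , w , u∈e , w∈e , ≢ = proper φ e∈ in
      u , w , u∈e , w∈e , ≢ ∘ inject≤-injective j≤k j≤k _ _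
  }

-- Finding a chromatic number constructively requires deciding colourability; the search runs over
-- codes of total maps. With no colours there is no junk value to make a map total, hence the
-- separate case.
coloring? : (G : Hypergraph n) (k : ℕ) → Dec (Coloring G k)
coloring? G zero with nonempty? (V G)
... | yes (v , v∈V) = no λ φ → case color φ (v , [ v∈V ]) of λ ()
... | no empty = yes record
  { color  = λ (v , [ v∈V ]) → contradiction-irr (v , v∈V) empty
  ; proper = λ e∈ → let v , v∈e = 2≤⇒nonempty (2≤∣e∣ G e∈) in
      contradiction (v , E⊆2^V G e∈ v∈e) empty
  }
coloring? {n} G (suc k) = map′ decode encode (any? λ x → proper? (finToFun x) (E G))
  where
  Encoded : Set
  Encoded = Σ[ x ∈ Fin (suc k ^ n) ] Proper (finToFun x) (E G)

  decode : Encoded → Coloring G (suc k)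
  decode (x , x-proper) = fromTotal G (finToFun x) x-proper

  encode : Coloring G (suc k) → Encoded
  encode φ = funToFin (total φ) , λ e∈ → let u , w , u∈e , w∈e , ≢ = total-proper φ e∈ in
    u , w , u∈e , w∈e , λ eq →
      ≢ (trans (sym (finToFun-funToFin (total φ) u)) (trans eq (finToFun-funToFin (total φ) w)))

chromaticNumber≤ : (G : Hypergraph n) → Coloring G k → ∃[ j ] HasChromaticNumber G j × j ≤ k
chromaticNumber≤ {k = zero} G φ = zero , (φ , λ _ → z≤n) , z≤n
chromaticNumber≤ {k = suc k} G φ with coloring? G k
... | yes ψ = let j , χ , j≤k = chromaticNumber≤ G ψ in j , χ , m≤n⇒m≤1+n j≤k
... | no ¬ψ = suc k , (φ , λ θ → ≮⇒≥ λ j<1+k → ¬ψ (liftColoring (s≤s⁻¹ j<1+k) θ)) , ≤-refl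

NoIsolated : Hypergraph n → Set
NoIsolated G = ∀ {v} → v ∈ V G → ∃[ e ] e ∈ₗ E G × v ∈ e

-- Excluding by `f ≢ e` exempts every occurrence of `e` at once, in keeping with lists whose
-- multiplicity has no meaning.
ProperOff : (Fin n → Fin k) → List (Subset n) → Subset n → Set
ProperOff c L e = ∀ {f} → f ∈ₗ L → f ≢ e → Split c f

recolor : Fin n → (Fin n → Fin k) → Fin n → Fin (suc k)
recolor u c v with v ≟ u
... | yes _ = zero
... | no _  = suc (c v)

-- An edge through `u` has a second vertex, which keeps an old colour; an edge avoiding `u` is not
-- `e`, so `c` already splits it.
recolor-proper : {c : Fin n → Fin k} {L : List (Subset n)} {e : Subset n} {u : Fin n} →
                 (∀ {f} → f ∈ₗ L → 2 ≤ ∣ f ∣) → u ∈ e → ProperOff c L e → Proper (recolor u c) L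
recolor-proper {c = c} {e = e} {u} 2≤ u∈e off {f} f∈ with u ∈? f
... | yes u∈f = let w , w∈f , w≢u = 2≤⇒∃≢ (2≤ f∈) u in u , w , u∈f , w∈f , apart w≢u
  where
  apart : ∀ {w} → w ≢ u → recolor u c u ≢ recolor u c w
  apart {w} w≢u eq with u ≟ u | w ≟ u
  ... | no u≢u | _       = u≢u refl
  ... | yes _  | yes w≡u = w≢u w≡u
  apart w≢u () | yes _ | no _
... | no u∉f with off f∈ (λ { refl → u∉f u∈e })
... | a , b , a∈f , b∈f , ca≢cb = a , b , a∈f , b∈f , apart
  where
  apart : recolor u c a ≢ recolor u c b
  apart eq with a ≟ u | b ≟ u
  ... | yes refl | _        = u∉f a∈f
  ... | no _     | yes refl = u∉f b∈f
  ... | no _     | no _     = ca≢cb (Fin.suc-injective eq)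

-- Without isolated vertices, losing a vertex also loses an edge. Every proper subhypergraph
-- therefore misses an edge, and colourings with a single edge deleted suffice.
critical⁺ : (G : Hypergraph n) →
            (∀ (c : Fin n → Fin (suc k)) → ¬ Proper c (E G)) →
            NoIsolated G →
            (∀ {e} → e ∈ₗ E G → Σ[ c ∈ (Fin n → Fin (suc k)) ] ProperOff c (E G) e) →
            Critical (suc (suc k)) G
critical⁺ {n} {k} G uncolorable noIsolated delete = (coloring , minimal) , sub
  where
  coloring : Coloring G (suc (suc k))
  -- The failure of a constant map supplies an edge to delete; one of its vertices then receives the
  -- extra colour.
  coloring with ¬proper⇒∃¬split (uncolorable (λ _ → zero))
  ... | e , e∈ , _ = let u , u∈e = 2≤⇒nonempty (2≤∣e∣ G e∈); c , off = delete e∈ in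
    fromTotal G (recolor u c) (recolor-proper (2≤∣e∣ G) u∈e off)

  minimal : ∀ {j} → Coloring G j → suc (suc k) ≤ j
  minimal φ = ≮⇒≥ λ j<2+k →
    let ψ = liftColoring (s≤s⁻¹ j<2+k) φ in uncolorable (total ψ) (total-proper ψ)

  sub : ∀ H → H ⊏ G → ∃[ j ] HasChromaticNumber H j × j < suc (suc k)
  sub H ((_ , EH⊆EG) , G⋢H) = let j , χ , j≤ = chromaticNumber≤ H colorH in j , χ , s≤s j≤
    where
    notAll : ¬ All.All (_∈ₗ E H) (E G)
    notAll all = G⋢H
      ( (λ v∈V → let e , e∈ , v∈e = noIsolated v∈V in E⊆2^V H (All.lookup all e∈) v∈e)
      , All.lookup all )

    colorH : Coloring H (suc k)
    colorH with find (¬All⇒Any¬ (_∈ₗ? E H) (E G) notAll)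
    ... | e , e∈G , e∉H = let c , off = delete e∈G in
      fromTotal H c λ f∈H → off (EH⊆EG f∈H) λ { refl → e∉H f∈H }

module _ (G : Hypergraph n) (crit : Critical (suc (suc k)) G) where

  critical⇒uncolorable : (c : Fin n → Fin (suc k)) → ¬ Proper c (E G)
  critical⇒uncolorable c c-proper = 1+n≰n (proj₂ (proj₁ crit) (fromTotal G c c-proper))

  critical⇒⊏-colorable : ∀ H → H ⊏ G → Σ[ c ∈ (Fin n → Fin (suc k)) ] Proper c (E H)
  critical⇒⊏-colorable H H⊏G with proj₂ crit H H⊏G
  ... | j , (φ , _) , j<2+k = let ψ = liftColoring (s≤s⁻¹ j<2+k) φ in total ψ , total-proper ψ

  critical⇒delete : ∀ {e} → e ∈ₗ E G → Σ[ c ∈ (Fin n → Fin (suc k)) ] ProperOff c (E G) e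
  critical⇒delete {e} e∈ = c , λ f∈ f≢e → c-proper (∈-filter⁺ keep? f∈ λ { (here f≡e) → f≢e f≡e })
    where
    keep? = λ f → ¬? (f ∈ₗ? (e ∷ []))
    G-e⊏G : (G -ᴱ (e ∷ [])) ⊏ G
    G-e⊏G = ((λ v∈ → v∈) , λ f∈ → proj₁ (∈-filter⁻ keep? {xs = E G} f∈)) ,
      λ (_ , E⊆) → proj₂ (∈-filter⁻ keep? {xs = E G} (E⊆ e∈)) (here refl)
    c = proj₁ (critical⇒⊏-colorable (G -ᴱ (e ∷ [])) G-e⊏G)
    c-proper = proj₂ (critical⇒⊏-colorable (G -ᴱ (e ∷ [])) G-e⊏G)

  critical⇒induced : ∀ {X} → X ⊆ V G → (∃[ v ] v ∈ V G × v ∉ X) →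
                     Σ[ c ∈ (Fin n → Fin (suc k)) ] (∀ {e} → e ∈ₗ E G → e ⊆ X → Split c e)
  critical⇒induced {X} X⊆V (v , v∈V , v∉X) =
    let c , c-proper = critical⇒⊏-colorable (G ⟦ X ⟧) G[X]⊏G in
    c , λ e∈ e⊆X → c-proper (∈-filter⁺ (_⊆? X) e∈ e⊆X)
    where
    G[X]⊏G : (G ⟦ X ⟧) ⊏ G
    G[X]⊏G = (X⊆V , λ f∈ → proj₁ (∈-filter⁻ (_⊆? X) {xs = E G} f∈)) ,
      λ (V⊆X , _) → v∉X (V⊆X v∈V)

  -- If no edge contained `v`, a colouring of G without `v` would already split every edge of G.
  critical⇒noIsolated : NoIsolated G
  critical⇒noIsolated {v} v∈V with Any.any? (v ∈?_) (E G)
  ... | yes found = find found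
  ... | no none = ⊥-elim (critical⇒uncolorable c c-proper)
    where
    sub = critical⇒induced {X = V G - v} (p─q⊆p (V G) ⁅ v ⁆)
            (v , v∈V , λ v∈ → x∈p─q⇒x∉q (V G) v∈ (x∈⁅x⁆ v))
    c = proj₁ sub
    c-proper : Proper c (E G)
    c-proper e∈ = proj₂ sub e∈ λ {w} w∈e →
      x∈p∧x≢y⇒x∈p-y (E⊆2^V G e∈ w∈e) λ { refl → none (lose e∈ w∈e) }

-- Separating edge sets

-- Symmetric in `X` and `Y`, since only the colourings decide later which side plays which role.
record Bipartition (W X Y : Subset n) : Set where
  field
    X≢∅      : Nonempty X
    Y≢∅      : Nonempty Y
    X⊆W      : X ⊆ W
    Y⊆W      : Y ⊆ W
    cover    : ∀ {v} → v ∈ W → v ∈ X ⊎ v ∈ Y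
    disjoint : ∀ {v} → v ∈ X → v ∉ Y

bipartition-swap : ∀ {W X Y : Subset n} → Bipartition W X Y → Bipartition W Y X
bipartition-swap B = record
  { X≢∅ = Y≢∅ ; Y≢∅ = X≢∅ ; X⊆W = Y⊆W ; Y⊆W = X⊆W
  ; cover = [ inj₂ , inj₁ ]′ ∘ cover
  ; disjoint = λ v∈Y v∈X → disjoint v∈X v∈Y
  }
  where open Bipartition B

Meets : Subset n → Subset n → Set
Meets e X = ∃[ v ] v ∈ e × v ∈ X

¬⊆⇒meets : ∀ {W X Y e : Subset n} → Bipartition W X Y → e ⊆ W → ¬ (e ⊆ X) → Meets e Y
¬⊆⇒meets {X = X} {Y} {e} B e⊆W e⊈X with any? (λ v → (v ∈? e) ×-dec (v ∈? Y))
... | yes found = found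
... | no none = ⊥-elim (e⊈X λ {v} v∈e → [ (λ v∈X → v∈X) , (λ v∈Y → contradiction (v , v∈e , v∈Y) none) ]′
                   (Bipartition.cover B (e⊆W v∈e)))

meets⇒¬⊆ : ∀ {W X Y e : Subset n} → Bipartition W X Y → Meets e Y → ¬ (e ⊆ X)
meets⇒¬⊆ B (v , v∈e , v∈Y) e⊆X = Bipartition.disjoint B (e⊆X v∈e) v∈Y

walk-reverse : (G : Hypergraph n) {u w : Fin n} → Linked G u w → Linked G w u
walk-reverse G = Star.reverse λ (e , e∈ , u∈e , w∈e) → e , e∈ , w∈e , u∈e

walk-stays : (G : Hypergraph n) {u w : Fin n} → u ∈ V G → Linked G u w → w ∈ V G
walk-stays G u∈V ε = u∈V
walk-stays G u∈V ((e , e∈ , _ , w∈e) ◅ walk) = walk-stays G (E⊆2^V G e∈ w∈e) walk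

walk-mono : (G H : Hypergraph n) {u w : Fin n} → E H ⊆ₗ E G → Linked H u w → Linked G u w
walk-mono G H H⊆G = Star.map λ (e , e∈ , u∈e , w∈e) → e , H⊆G e∈ , u∈e , w∈e

whole-component⇒unique : (G : Hypergraph n) {C D : Subset n} →
                         IsComponent G C → V G ⊆ C → IsComponent G D → D ≡ C
whole-component⇒unique G {C} {D} (v , v∈V , C⇔) V⊆C (w , w∈V , D⇔) = ⊆-antisym
  (λ u∈D → V⊆C (walk-stays G w∈V (Equivalence.to (D⇔ _) u∈D)))
  (λ u∈C → Equivalence.from (D⇔ _)
     (walk-reverse G (Equivalence.to (C⇔ _) (V⊆C w∈V)) ◅◅ Equivalence.to (C⇔ _) u∈C))

-- One side is a component `C` of `G -ᴱ F`, provided it misses a vertex of G: an edge outside `F`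
-- that meets both sides would prolong a walk beyond `C`.
separating⇒bipartition : {G : Hypergraph n} {F : List (Subset n)} → IsSeparating G F →
  ∃[ X ] ∃[ Y ] Bipartition (V G) X Y ×
    (∀ {e} → e ∈ₗ E G → Meets e X → Meets e Y → e ∈ₗ F)
separating⇒bipartition {n} {G} {F} sep
  with m , m′ , (Ds , _ , Ds⇔ , refl) , (Cs , Cs-unique , Cs⇔ , refl) , m<m′ ← IsSeparating.moreComponents sep
  = go Cs Cs-unique Cs⇔ m<m′
  where
  keep? = λ e → ¬? (e ∈ₗ? F)

  E⁻ : E (G -ᴱ F) ⊆ₗ E G
  E⁻ e∈ = proj₁ (∈-filter⁻ keep? {xs = E G} e∈)

  go : ∀ Cs → Unique Cs → (∀ C → C ∈ₗ Cs ⇔ IsComponent (G -ᴱ F) C) → length Ds < length Cs →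
       ∃[ X ] ∃[ Y ] Bipartition (V G) X Y × (∀ {e} → e ∈ₗ E G → Meets e X → Meets e Y → e ∈ₗ F)
  go (C ∷ Cs) uniq Cs⇔ Ds<Cs with Equivalence.to (Cs⇔ C) (here refl)
  ... | compC@(v , v∈V , C⇔) with any? (λ u → (u ∈? V G) ×-dec ¬? (u ∈? C))
  ...   | yes (w , w∈V , w∉C) = C , V G ─ C , bip , cross
    where
    bip : Bipartition (V G) C (V G ─ C)
    bip = record
      { X≢∅ = v , Equivalence.from (C⇔ v) ε
      ; Y≢∅ = w , x∈p∧x∉q⇒x∈p─q w∈V w∉C
      ; X⊆W = λ u∈C → walk-stays (G -ᴱ F) v∈V (Equivalence.to (C⇔ _) u∈C)
      ; Y⊆W = p─q⊆p (V G) C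
      ; cover = cov
      ; disjoint = λ u∈C u∈V─C → x∈p─q⇒x∉q (V G) u∈V─C u∈C
      }
      where
      cov : ∀ {u} → u ∈ V G → u ∈ C ⊎ u ∈ V G ─ C
      cov {u} u∈V with u ∈? C
      ... | yes u∈C = inj₁ u∈C
      ... | no u∉C = inj₂ (x∈p∧x∉q⇒x∈p─q u∈V u∉C)
    cross : ∀ {e} → e ∈ₗ E G → Meets e C → Meets e (V G ─ C) → e ∈ₗ F
    cross {e} e∈ (a , a∈e , a∈C) (b , b∈e , b∈V─C) = decidable-stable (e ∈ₗ? F) λ e∉F →
      x∈p─q⇒x∉q (V G) b∈V─C (Equivalence.from (C⇔ b)
        (Equivalence.to (C⇔ a) a∈C ◅◅ (e , ∈-filter⁺ keep? e∈ e∉F , a∈e , b∈e) ◅ ε))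
  ...   | no none = ⊥-elim (noMore uniq (λ D → Equivalence.to (Cs⇔ D)) Ds<Cs (Equivalence.from (Ds⇔ C) C-in-G))
    where
    V⊆C : V G ⊆ C
    V⊆C {u} u∈V = decidable-stable (u ∈? C) λ u∉C → none (u , u∈V , u∉C)

    -- If C is all of V(G), then C is also a component of G, so G - F has no more components than G.
    C-in-G : IsComponent G C
    C-in-G = v , v∈V , λ u → mk⇔
      (λ u∈C → walk-mono G (G -ᴱ F) E⁻ (Equivalence.to (C⇔ u) u∈C))
      (λ walk → V⊆C (walk-stays G v∈V walk))

    -- If `C` is in `Ds`, the strict inequality provides a second component `D` of `G -ᴱ F`; but `C`
    -- fills the vertex set, so `D` equals `C`, against uniqueness.
    noMore : ∀ {Cs Ds} → Unique (C ∷ Cs) → (∀ D → D ∈ₗ C ∷ Cs → IsComponent (G -ᴱ F) D) →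
             length Ds < length (C ∷ Cs) → ¬ C ∈ₗ Ds
    noMore {[]} {_ ∷ _} _ _ (s≤s ())
    noMore {D ∷ _} ((C≢D All.∷ _) ∷ _) comps _ _ =
      C≢D (sym (whole-component⇒unique (G -ᴱ F) compC V⊆C (comps D (there (here refl)))))

-- The two sides of the cut

Mono : (Fin n → Fin k) → Subset n → Subset n → Fin k → Set
Mono c e S i = ∀ v → v ∈ e → v ∈ S → c v ≡ i

ProperIn : Hypergraph n → Subset n → (Fin n → Fin k) → Set
ProperIn G S c = ∀ {e} → e ∈ₗ E G → e ⊆ S → Split c e

Single : List (Subset n) → Subset n → (Fin n → Fin k) → Set
Single F S c = ∃[ i ] ∀ {e} → e ∈ₗ F → Mono c e S i

-- Taking `u` and `w` equal in `distinct` shows that a vertex of `S` lies in at most one edge of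
-- `F`, which is how (b) arises.
record Rainbow (F : List (Subset n)) (S : Subset n) (c : Fin n → Fin k) : Set where
  field
    onto     : ∀ i → ∃[ e ] e ∈ₗ F × Mono c e S i
    distinct : ∀ {e f u w} → e ∈ₗ F → f ∈ₗ F → u ∈ e → u ∈ S → w ∈ f → w ∈ S →
               c u ≡ c w → e ≡ f

-- Two colours exist, and the edges that are monochromatic in them would both carry the single
-- colour.
single⇒¬rainbow : ∀ {F S} (c : Fin n → Fin (suc (suc k))) → (∀ {e} → e ∈ₗ F → Meets e S) →
                  Single F S c → ¬ Rainbow F S c
single⇒¬rainbow c meets (i , mono) rainbow =
  let e , e∈ , e-mono = Rainbow.onto rainbow zero
      f , f∈ , f-mono = Rainbow.onto rainbow (suc zero)
      u , u∈e , u∈S = meets e∈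
      w , w∈f , w∈S = meets f∈
  in case trans (trans (sym (e-mono u u∈e u∈S)) (mono e∈ u u∈e u∈S))
                (trans (sym (mono f∈ w w∈f w∈S)) (f-mono w w∈f w∈S))
     of λ ()

glue : Subset n → (Fin n → Fin k) → (Fin n → Fin k) → Fin n → Fin k
glue X a b v with v ∈? X
... | yes _ = a v
... | no _  = b v

glue-inside : ∀ {X v} {a b : Fin n → Fin k} → v ∈ X → glue X a b v ≡ a v
glue-inside {X = X} {v} v∈X with v ∈? X
... | yes _  = refl
... | no v∉X = contradiction v∈X v∉X

glue-outside : ∀ {X v} {a b : Fin n → Fin k} → v ∉ X → glue X a b v ≡ b v
glue-outside {X = X} {v} v∉X with v ∈? X
... | yes v∈X = contradiction v∈X v∉X
... | no _    = refl

split-cong : ∀ {c d : Fin n → Fin k} {e} → (∀ {v} → v ∈ e → c v ≡ d v) → Split c e → Split d e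
split-cong c≡d (u , w , u∈e , w∈e , cu≢cw) =
  u , w , u∈e , w∈e , λ du≡dw → cu≢cw (trans (c≡d u∈e) (trans du≡dw (sym (c≡d w∈e))))

module _ {F : List (Subset n)} {S : Subset n} {c : Fin n → Fin k} (r : Fin (length F) → Fin k)
         (mono : ∀ x → Mono c (lookup F x) S (r x)) where

  private
    mono-index : ∀ {e} (e∈ : e ∈ₗ F) → Mono c e S (r (index e∈))
    mono-index e∈ = subst (λ e → Mono c e S (r (index e∈))) (sym (lookup-index e∈)) (mono (index e∈))

  constant⇒single : Fin (length F) → Constant r → Single F S c
  constant⇒single x r-const =
    r x , λ e∈ v v∈e v∈S → trans (mono-index e∈ v v∈e v∈S) (r-const (index e∈) x)

  injective⇒rainbow : k ≤ length F → Injective _≡_ _≡_ r → Rainbow F S c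
  injective⇒rainbow k≤∣F∣ r-injective = record
    { onto = onto
    ; distinct = λ e∈ f∈ u∈e u∈S w∈f w∈S cu≡cw →
        trans (lookup-index e∈) (trans (cong (lookup F) (r-injective
          (trans (sym (mono-index e∈ _ u∈e u∈S)) (trans cu≡cw (mono-index f∈ _ w∈f w∈S)))))
          (sym (lookup-index f∈)))
    }
    where
    onto : ∀ i → ∃[ e ] e ∈ₗ F × Mono c e S i
    onto i with injective⇒surjective k≤∣F∣ r-injective i
    ... | x , refl = lookup F x , ∈-lookup x , mono x

module Sides (G : Hypergraph n) {X Y : Subset n} (B : Bipartition (V G) X Y) (F : List (Subset n))
             (uncolorable : (c : Fin n → Fin (suc k)) → ¬ Proper c (E G))
             (cross : ∀ {e} → e ∈ₗ E G → Meets e X → Meets e Y → e ∈ₗ F)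
             (F≤k : length F ≤ suc k) where

  open Bipartition B

  module _ {a b : Fin n → Fin (suc k)} (a-proper : ProperIn G X a) (b-proper : ProperIn G Y b) where

    -- `Mono` holds vacuously for an edge that misses the side; the two `Meets` fields make `i` and
    -- `j` determined by the edge.
    record Cell (e : Subset n) (i j : Fin (suc k)) : Set where
      constructor mkCell
      field
        meetsX : Meets e X
        meetsY : Meets e Y
        a-mono : Mono a e X i
        b-mono : Mono b e Y j

    cell-functional : ∀ {e i j i′ j′} → Cell e i j → Cell e i′ j′ → i ≡ i′ × j ≡ j′
    cell-functional (mkCell (u , u∈e , u∈X) (w , w∈e , w∈Y) a-mono b-mono) (mkCell _ _ a-mono′ b-mono′) =
      trans (sym (a-mono u u∈e u∈X)) (a-mono′ u u∈e u∈X) ,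
      trans (sym (b-mono w w∈e w∈Y)) (b-mono′ w w∈e w∈Y)

    -- Otherwise a and σ ∘ b would glue to a proper colouring of G.
    cell-hit : ∀ σ → Injective _≡_ _≡_ σ → ∃[ e ] e ∈ₗ F × ∃[ j ] Cell e (σ j) j
    cell-hit σ σ-injective =
      e , cross e∈ meetsX meetsY , b w , mkCell meetsX meetsY a-mono b-mono
      where
      c = glue X a (σ ∘ b)
      bad = ¬proper⇒∃¬split (uncolorable c)
      e = proj₁ bad
      e∈ = proj₁ (proj₂ bad)
      ¬split = proj₂ (proj₂ bad)

      c-X : ∀ {v} → v ∈ X → c v ≡ a v
      c-X = glue-inside {a = a} {σ ∘ b}

      c-Y : ∀ {v} → v ∈ Y → c v ≡ σ (b v)
      c-Y v∈Y = glue-outside {a = a} {σ ∘ b} λ v∈X → disjoint v∈X v∈Y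

      meetsY : Meets e Y
      meetsY = ¬⊆⇒meets B (E⊆2^V G e∈) λ e⊆X →
        ¬split (split-cong (λ v∈e → sym (c-X (e⊆X v∈e))) (a-proper e∈ e⊆X))

      meetsX : Meets e X
      meetsX = ¬⊆⇒meets (bipartition-swap B) (E⊆2^V G e∈) λ e⊆Y →
        ¬split (split-cong (λ v∈e → sym (c-Y (e⊆Y v∈e))) (split-∘ σ-injective (b-proper e∈ e⊆Y)))

      w = proj₁ meetsY

      a-mono : Mono a e X (σ (b w))
      a-mono v v∈e v∈X = trans (sym (c-X v∈X))
        (trans (¬split⇒≡ ¬split v∈e (proj₁ (proj₂ meetsY))) (c-Y (proj₂ (proj₂ meetsY))))

      b-mono : Mono b e Y (b w)
      b-mono v v∈e v∈Y = σ-injective (trans (sym (c-Y v∈Y))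
        (trans (¬split⇒≡ ¬split v∈e (proj₁ (proj₂ meetsY))) (c-Y (proj₂ (proj₂ meetsY)))))

    hits : ∀ σ → Injective _≡_ _≡_ σ → ∃[ x ] ∃[ j ] Cell (lookup F x) (σ j) j
    hits σ σ-injective = let e , e∈ , j , cell = cell-hit σ σ-injective in
      index e∈ , j , subst (λ e → Cell e (σ j) j) (lookup-index e∈) cell

    k≤∣F∣ : suc k ≤ length F
    k≤∣F∣ = blocking-size (λ x → Cell (lookup F x)) cell-functional F≤k hits

    x₀ : Fin (length F)
    x₀ = fromℕ< (≤-trans (s≤s z≤n) k≤∣F∣)

    dichotomy : 2 ≤ suc k →
      (∀ {e} → e ∈ₗ F → Meets e X × Meets e Y) ×
      ((Single F X a × Rainbow F Y b) ⊎ (Rainbow F X a × Single F Y b))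
    dichotomy 2≤k =
      let p , q , cell , shape =
            blocking⇒row-or-column (λ x → Cell (lookup F x)) cell-functional F≤k hits 2≤k
      in crossing p q cell , sides p q cell shape
      where
      module _ (p q : Fin (length F) → Fin (suc k)) (cell : ∀ x → Cell (lookup F x) (p x) (q x)) where
        crossing : ∀ {e} → e ∈ₗ F → Meets e X × Meets e Y
        crossing e∈ = subst (λ e → Meets e X × Meets e Y) (sym (lookup-index e∈))
          (Cell.meetsX (cell (index e∈)) , Cell.meetsY (cell (index e∈)))

        sides : (Constant p × Injective _≡_ _≡_ q) ⊎ (Injective _≡_ _≡_ p × Constant q) →
                (Single F X a × Rainbow F Y b) ⊎ (Rainbow F X a × Single F Y b)
        sides (inj₁ (p-const , q-inj)) =
          inj₁ ( constant⇒single p (λ x → Cell.a-mono (cell x)) x₀ p-const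
               , injective⇒rainbow q (λ x → Cell.b-mono (cell x)) k≤∣F∣ q-inj )
        sides (inj₂ (p-inj , q-const)) =
          inj₂ ( injective⇒rainbow p (λ x → Cell.a-mono (cell x)) k≤∣F∣ p-inj
               , constant⇒single q (λ x → Cell.b-mono (cell x)) x₀ q-const )

-- Properties (a) to (d) once the roles of the two sides are fixed

∈-⋃⁺ : ∀ {v : Fin n} {e F} → e ∈ₗ F → v ∈ e → v ∈ ⋃ F
∈-⋃⁺ {F = f ∷ F} (here refl) v∈e = x∈p∪q⁺ (inj₁ v∈e)
∈-⋃⁺ {F = f ∷ F} (there e∈) v∈e = x∈p∪q⁺ {p = f} (inj₂ (∈-⋃⁺ e∈ v∈e))

∈-⋃⁻ : ∀ {v : Fin n} F → v ∈ ⋃ F → ∃[ e ] e ∈ₗ F × v ∈ e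
∈-⋃⁻ [] v∈ = contradiction v∈ ∉⊥
∈-⋃⁻ (f ∷ F) v∈ with x∈p∪q⁻ f (⋃ F) v∈
... | inj₁ v∈f = f , here refl , v∈f
... | inj₂ v∈⋃ = let e , e∈ , v∈e = ∈-⋃⁻ F v∈⋃ in e , there e∈ , v∈e

split-there : ∀ {c : Fin (suc n) → Fin k} {s e} → Split (c ∘ suc) e → Split c (s Vec.∷ e)
split-there (u , w , u∈e , w∈e , ≢) = suc u , suc w , Vec.there u∈e , Vec.there w∈e , ≢

split-outside : ∀ {c : Fin (suc n) → Fin k} {e} → Split c (outside Vec.∷ e) → Split (c ∘ suc) e
split-outside (suc u , suc w , Vec.there u∈e , Vec.there w∈e , ≢) = u , w , u∈e , w∈e , ≢

mono⇒¬split : ∀ {c : Fin n → Fin k} {e i} → (∀ {v} → v ∈ e → c v ≡ i) → ¬ Split c e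
mono⇒¬split mono (u , w , u∈e , w∈e , ≢) = ≢ (trans (mono u∈e) (sym (mono w∈e)))

extend : Fin k → (Fin n → Fin k) → Fin (suc n) → Fin k
extend i c zero    = i
extend i c (suc v) = c v

critical⇒side : (G : Hypergraph n) → Critical (suc (suc k)) G → ∀ {X Y} → Bipartition (V G) X Y →
                Σ[ c ∈ (Fin n → Fin (suc k)) ] ProperIn G X c
critical⇒side G crit B = critical⇒induced G crit X⊆W
  (proj₁ Y≢∅ , Y⊆W (proj₂ Y≢∅) , λ v∈X → disjoint v∈X (proj₂ Y≢∅))
  where open Bipartition B

CutProperties : ℕ → Hypergraph n → List (Subset n) → Subset n → Subset n → Set
CutProperties k G F X Y = Σ[ cut ∈ IsEdgeCut G X Y F ]
  ((∀ (φ : Coloring (G ⟦ X ⟧) k) → ∣ image φ (ends X F) ∣ ≡ 1) ×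
   (∀ (φ : Coloring (G ⟦ Y ⟧) k) →
      ∣ image φ (ends Y F) ∣ ≡ k ×
      (∀ (i : Fin k) → ∃[ e ] e ∈ₗ F × image φ (e ∩ Y) ≡ ⁅ i ⁆))) ×
  (∀ v → v ∈ ends Y F → ∃! _≡_ (λ e → e ∈ₗ F × v ∈ e)) ×
  ((2≤∣XF∣ : 2 ≤ ∣ ends X F ∣) →
     Critical (suc k) (addEdge (G ⟦ X ⟧) (ends X F) (ends-⊆ X F) 2≤∣XF∣)) ×
  Critical (suc k) (contract G cut)

module Conclusion (G : Hypergraph n) (crit : Critical (suc (suc k)) G)
                  {X Y : Subset n} (B : Bipartition (V G) X Y)
                  {F : List (Subset n)} (F⊆E : F ⊆ₗ E G)
                  (cross : ∀ {e} → e ∈ₗ E G → Meets e X → Meets e Y → e ∈ₗ F)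
                  (crossing : ∀ {e} → e ∈ₗ F → Meets e X × Meets e Y)
                  (single : ∀ {c : Fin n → Fin (suc k)} → ProperIn G X c → Single F X c)
                  (rainbow : ∀ {c : Fin n → Fin (suc k)} → ProperIn G Y c → Rainbow F Y c) where

  open Bipartition B

  Y≡V─X : Y ≡ V G ─ X
  Y≡V─X = ⊆-antisym
    (λ v∈Y → x∈p∧x∉q⇒x∈p─q (Y⊆W v∈Y) λ v∈X → disjoint v∈X v∈Y)
    (λ v∈V─X → [ (λ v∈X → contradiction v∈X (x∈p─q⇒x∉q (V G) v∈V─X)) , (λ v∈Y → v∈Y) ]′
                 (cover (p─q⊆p (V G) X v∈V─X)))

  cut : IsEdgeCut G X Y F
  cut = record
    { X≢∅   = X≢∅
    ; X⊂V   = X⊆W , proj₁ Y≢∅ , Y⊆W (proj₂ Y≢∅) , λ v∈X → disjoint v∈X (proj₂ Y≢∅)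
    ; Y≡V∖X = Y≡V─X
    ; F∼∂X  = mk⇔ F⊆∂ ∂⊆F
    }
    where
    F⊆∂ : ∀ {e} → e ∈ₗ F → e ∈ₗ ∂ G X
    F⊆∂ {e} e∈ = let (u , u∈e , u∈X) , (w , w∈e , w∈Y) = crossing e∈ in
      ∈-filter⁺ _ (F⊆E e∈)
        ((u , x∈p∩q⁺ (u∈e , u∈X)) , (w , x∈p∩q⁺ (w∈e , subst (w ∈_) Y≡V─X w∈Y)))

    ∂⊆F : ∀ {e} → e ∈ₗ ∂ G X → e ∈ₗ F
    ∂⊆F {e} e∈ with ∈-filter⁻ _ {xs = E G} e∈
    ... | e∈E , (u , u∈) , (w , w∈) =
      let u∈e , u∈X = x∈p∩q⁻ e X u∈ ; w∈e , w∈V─X = x∈p∩q⁻ e (V G ─ X) w∈ in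
      cross e∈E (u , u∈e , u∈X) (w , w∈e , subst (w ∈_) (sym Y≡V─X) w∈V─X)

  ⊆Y⇒⊈X : ∀ {e} → e ∈ₗ E G → e ⊆ Y → ¬ (e ⊆ X)
  ⊆Y⇒⊈X e∈ e⊆Y e⊆X = let v , v∈e = 2≤⇒nonempty (2≤∣e∣ G e∈) in disjoint (e⊆X v∈e) (e⊆Y v∈e)

  inside⁺ : ∀ {S e} → e ∈ₗ E G → e ⊆ S → e ∈ₗ E (G ⟦ S ⟧)
  inside⁺ {S} = ∈-filter⁺ (_⊆? S)

  inside⁻ : ∀ {S e} → e ∈ₗ E (G ⟦ S ⟧) → e ∈ₗ E G × e ⊆ S
  inside⁻ {S} = ∈-filter⁻ (_⊆? S) {xs = E G}

  ends⁺ : ∀ {S e v} → e ∈ₗ F → v ∈ e → v ∈ S → v ∈ ends S F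
  ends⁺ e∈ v∈e v∈S = x∈p∩q⁺ (v∈S , ∈-⋃⁺ e∈ v∈e)

  ends⁻ : ∀ {S v} → v ∈ ends S F → v ∈ S × ∃[ e ] e ∈ₗ F × v ∈ e
  ends⁻ {S} v∈ = let v∈S , v∈⋃ = x∈p∩q⁻ S (⋃ F) v∈ in v∈S , ∈-⋃⁻ F v∈⋃

  -- Facts that mention no colouring, such as (b) and the existence of an edge in `F`, are read off
  -- this one colouring of G[Y].
  rainbowY : Rainbow F Y (proj₁ (critical⇒side G crit (bipartition-swap B)))
  rainbowY = rainbow (proj₂ (critical⇒side G crit (bipartition-swap B)))

  someF : ∃[ e ] e ∈ₗ F
  someF = let e , e∈ , _ = Rainbow.onto rainbowY zero in e , e∈

  single-ends : ∀ {c : Fin n → Fin (suc k)} → ProperIn G X c →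
                ∃[ i ] ∀ {v} → v ∈ ends X F → c v ≡ i
  single-ends c-proper = let i , mono = single c-proper in
    i , λ v∈ → let v∈X , e , e∈ , v∈e = ends⁻ v∈ in mono e∈ _ v∈e v∈X

  partA-X : (φ : Coloring (G ⟦ X ⟧) (suc k)) → ∣ image φ (ends X F) ∣ ≡ 1
  partA-X φ = trans (cong ∣_∣ (image-monochromatic φ (ends-⊆ X F) nonempty (proj₂ mono)))
                    (∣⁅x⁆∣≡1 (proj₁ mono))
    where
    mono = single-ends {total φ} λ e∈ e⊆X → total-proper φ (inside⁺ e∈ e⊆X)
    nonempty : Nonempty (ends X F)
    nonempty = let e , e∈ = someF ; (u , u∈e , u∈X) , _ = crossing e∈ in u , ends⁺ e∈ u∈e u∈X

  module _ (φ : Coloring (G ⟦ Y ⟧) (suc k)) where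
    private
      r : Rainbow F Y (total φ)
      r = rainbow λ e∈ e⊆Y → total-proper φ (inside⁺ e∈ e⊆Y)

    partA-Y : ∣ image φ (ends Y F) ∣ ≡ suc k
    partA-Y = trans (cong ∣_∣ (image-full φ (ends-⊆ Y F) onto)) (∣⊤∣≡n (suc k))
      where
      onto : ∀ i → ∃[ v ] v ∈ ends Y F × total φ v ≡ i
      onto i = let e , e∈ , mono = Rainbow.onto r i
                   _ , (w , w∈e , w∈Y) = crossing e∈
               in w , ends⁺ e∈ w∈e w∈Y , mono w w∈e w∈Y

    partA-Y-edges : ∀ i → ∃[ e ] e ∈ₗ F × image φ (e ∩ Y) ≡ ⁅ i ⁆
    partA-Y-edges i =
      let e , e∈ , mono = Rainbow.onto r i
          _ , (w , w∈e , w∈Y) = crossing e∈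
      in e , e∈ , image-monochromatic φ (λ v∈ → proj₂ (x∈p∩q⁻ e Y v∈)) (w , x∈p∩q⁺ (w∈e , w∈Y))
           λ v∈ → let v∈e , v∈Y = x∈p∩q⁻ e Y v∈ in mono _ v∈e v∈Y

  partB : ∀ v → v ∈ ends Y F → ∃! _≡_ (λ e → e ∈ₗ F × v ∈ e)
  partB v v∈ = let v∈Y , e , e∈ , v∈e = ends⁻ v∈ in
    e , (e∈ , v∈e) , λ (f∈ , v∈f) → Rainbow.distinct rainbowY e∈ f∈ v∈e v∈Y v∈f v∈Y refl

  module _ (2≤∣XF∣ : 2 ≤ ∣ ends X F ∣) where
    private
      G⁺ : Hypergraph n
      G⁺ = addEdge (G ⟦ X ⟧) (ends X F) (ends-⊆ X F) 2≤∣XF∣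

    addEdge-uncolorable : (c : Fin n → Fin (suc k)) → ¬ Proper c (E G⁺)
    addEdge-uncolorable c c-proper = mono⇒¬split (proj₂ mono) (c-proper (here refl))
      where mono = single-ends {c} λ e∈ e⊆X → c-proper (there (inside⁺ e∈ e⊆X))

    addEdge-noIsolated : NoIsolated G⁺
    addEdge-noIsolated v∈X with critical⇒noIsolated G crit (X⊆W v∈X)
    ... | e , e∈ , v∈e with e ⊆? X
    ...   | yes e⊆X = e , there (inside⁺ e∈ e⊆X) , v∈e
    ...   | no e⊈X  = ends X F , here refl ,
      ends⁺ (cross e∈ (_ , v∈e , v∈X) (¬⊆⇒meets B (E⊆2^V G e∈) e⊈X)) v∈e v∈X

    -- Deleting an edge inside X leaves a colouring that is rainbow on Y; were it constant on X_F,
    -- some edge of F would be monochromatic.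
    split-ends : ∀ {e} {c : Fin n → Fin (suc k)} → e ∈ₗ E G → e ⊆ X → ProperOff c (E G) e →
                 Split c (ends X F)
    split-ends {e} {c} e∈ e⊆X off with split? c (ends X F)
    ... | yes split = split
    ... | no ¬split = ⊥-elim (mono⇒¬split f-mono (off (F⊆E f∈) f≢e))
      where
      u = 2≤⇒nonempty 2≤∣XF∣
      r : Rainbow F Y c
      r = rainbow λ g∈ g⊆Y → off g∈ λ { refl → ⊆Y⇒⊈X g∈ g⊆Y e⊆X }
      -- The edge of `F` whose part in `Y` has the colour that `c` would take on all of X_F.
      f = proj₁ (Rainbow.onto r (c (proj₁ u)))
      f∈ = proj₁ (proj₂ (Rainbow.onto r (c (proj₁ u))))
      f≢e : f ≢ e
      f≢e f≡e = meets⇒¬⊆ B (proj₂ (crossing f∈)) (subst (_⊆ X) (sym f≡e) e⊆X)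
      f-mono : ∀ {v} → v ∈ f → c v ≡ c (proj₁ u)
      f-mono v∈f = [ (λ v∈X → ¬split⇒≡ ¬split (ends⁺ f∈ v∈f v∈X) (proj₂ u))
                   , (λ v∈Y → proj₂ (proj₂ (Rainbow.onto r (c (proj₁ u)))) _ v∈f v∈Y)
                   ]′ (cover (E⊆2^V G (F⊆E f∈) v∈f))

    addEdge-delete : ∀ {e} → e ∈ₗ E G⁺ → Σ[ c ∈ (Fin n → Fin (suc k)) ] ProperOff c (E G⁺) e
    -- With X_F deleted, any colouring of G[X] will do; it exists because G is critical.
    addEdge-delete (here refl) = proj₁ (critical⇒side G crit B) , λ
      { (here refl) f≢ → contradiction refl f≢
      ; (there f∈)  _  → let f∈E , f⊆X = inside⁻ f∈ in proj₂ (critical⇒side G crit B) f∈E f⊆X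
      }
    addEdge-delete (there e∈) =
      let e∈E , e⊆X = inside⁻ e∈ ; c , off = critical⇒delete G crit e∈E in
      c , λ { (here refl) _   → split-ends e∈E e⊆X off
            ; (there f∈)  f≢e → off (proj₁ (inside⁻ f∈)) f≢e
            }

    partC : Critical (suc (suc k)) G⁺
    partC = critical⁺ G⁺ addEdge-uncolorable addEdge-noIsolated addEdge-delete

  private
    G′ : Hypergraph (suc n)
    G′ = contract G cut

  data ContractedEdge : Subset (suc n) → Set where
    old : ∀ {e} → e ∈ₗ E G → e ⊆ Y → ContractedEdge (outside Vec.∷ e)
    new : ∀ {e} → e ∈ₗ F → ContractedEdge (inside Vec.∷ (e ─ X))

  contract⁻ : ∀ {e} → e ∈ₗ E G′ → ContractedEdge e
  contract⁻ e∈ with ∈-++⁻ (map (outside Vec.∷_) (E (G ⟦ Y ⟧))) e∈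
  ... | inj₁ e∈old with f , f∈ , refl ← ∈-map⁻ _ e∈old = let f∈E , f⊆Y = inside⁻ f∈ in old f∈E f⊆Y
  ... | inj₂ e∈new with f , f∈ , refl ← ∈-map⁻ _ e∈new = new f∈

  contract⁺ : ∀ {e} → ContractedEdge e → e ∈ₗ E G′
  contract⁺ (old e∈ e⊆Y) = ∈-++⁺ˡ (∈-map⁺ _ (inside⁺ e∈ e⊆Y))
  contract⁺ (new e∈) = ∈-++⁺ʳ (map (outside Vec.∷_) (E (G ⟦ Y ⟧))) (∈-map⁺ (λ e → inside Vec.∷ (e ─ X)) e∈)

  -- On `Y` such a colouring would be rainbow, so some edge of `F` has there the colour of the new
  -- vertex, and its contracted edge is monochromatic.
  contract-uncolorable : (c : Fin (suc n) → Fin (suc k)) → ¬ Proper c (E G′)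
  contract-uncolorable c c-proper =
    let e , e∈ , mono = Rainbow.onto r (c zero) in
    mono⇒¬split (λ { {zero} _ → refl ; {suc v} (Vec.there v∈) → mono v (p─q⊆p e X v∈) (─X⊆Y e∈ v∈) })
      (c-proper (contract⁺ (new e∈)))
    where
    ─X⊆Y : ∀ {e v} → e ∈ₗ F → v ∈ e ─ X → v ∈ Y
    ─X⊆Y {e} e∈ v∈ = [ (λ v∈X → contradiction v∈X (x∈p─q⇒x∉q e v∈)) , (λ v∈Y → v∈Y) ]′
                       (cover (E⊆2^V G (F⊆E e∈) (p─q⊆p e X v∈)))
    r : Rainbow F Y (c ∘ suc)
    r = rainbow λ e∈ e⊆Y → split-outside (c-proper (contract⁺ (old e∈ e⊆Y)))

  contract-noIsolated : NoIsolated G′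
  contract-noIsolated {zero} _ = let e , e∈ = someF in _ , contract⁺ (new e∈) , Vec.here
  contract-noIsolated {suc v} (Vec.there v∈Y) with critical⇒noIsolated G crit (Y⊆W v∈Y)
  ... | e , e∈ , v∈e with e ⊆? Y
  ...   | yes e⊆Y = _ , contract⁺ (old e∈ e⊆Y) , Vec.there v∈e
  ...   | no e⊈Y  = _ ,
    contract⁺ (new (cross e∈ (¬⊆⇒meets (bipartition-swap B) (E⊆2^V G e∈) e⊈Y) (v , v∈e , v∈Y))) ,
    Vec.there (x∈p∧x∉q⇒x∈p─q v∈e λ v∈X → disjoint v∈X v∈Y)

  -- X_F is monochromatic, so the new vertex can take its colour.
  contract-off : ∀ {e e′} → e ∈ₗ E G → ¬ (e ⊆ X) →
                 (∀ {f} → f ∈ₗ E G → f ⊆ Y → outside Vec.∷ f ≢ e′ → f ≢ e) →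
                 (∀ {f} → f ∈ₗ F → inside Vec.∷ (f ─ X) ≢ e′ → f ≢ e) →
                 Σ[ c ∈ (Fin (suc n) → Fin (suc k)) ] ProperOff c (E G′) e′
  contract-off {e} {e′} e∈ e⊈X old≢ new≢ = c′ , λ f∈ f≢ → split (contract⁻ f∈) f≢
    where
    c = proj₁ (critical⇒delete G crit e∈)
    off : ProperOff c (E G) e
    off = proj₂ (critical⇒delete G crit e∈)
    -- The deleted edge does not lie inside `X`, so `c` is still proper there.
    mono = single {c} λ f∈ f⊆X → off f∈ λ { refl → e⊈X f⊆X }
    c′ = extend (proj₁ mono) c

    split : ∀ {f} → ContractedEdge f → f ≢ e′ → Split c′ f
    split (old f∈ f⊆Y) f≢ = split-there (off f∈ (old≢ f∈ f⊆Y f≢))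
    split (new {f} f∈) f≢ with split? c′ (inside Vec.∷ (f ─ X))
    ... | yes f-split = f-split
    -- An unsplit contracted edge gives `f` outside `X` the colour of the new vertex, which is also
    -- its colour inside `X`; so `c` would fail on `f` itself.
    ... | no ¬split = ⊥-elim (mono⇒¬split f-mono (off (F⊆E f∈) (new≢ f∈ f≢)))
      where
      f-mono : ∀ {v} → v ∈ f → c v ≡ proj₁ mono
      f-mono {v} v∈f with v ∈? X
      ... | yes v∈X = proj₂ mono f∈ v v∈f v∈X
      ... | no v∉X = ¬split⇒≡ ¬split (Vec.there (x∈p∧x∉q⇒x∈p─q v∈f v∉X)) Vec.here

  contract-delete : ∀ {e} → e ∈ₗ E G′ → Σ[ c ∈ (Fin (suc n) → Fin (suc k)) ] ProperOff c (E G′) e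
  contract-delete e∈ with contract⁻ e∈
  ... | old {e} e∈E e⊆Y = contract-off e∈E (⊆Y⇒⊈X e∈E e⊆Y)
    (λ _ _ f≢ f≡e → f≢ (cong (outside Vec.∷_) f≡e))
    (λ f∈ _ f≡e → meets⇒¬⊆ (bipartition-swap B) (proj₁ (crossing f∈)) (subst (_⊆ Y) (sym f≡e) e⊆Y))
  ... | new {e} e∈F = contract-off (F⊆E e∈F) (meets⇒¬⊆ B (proj₂ (crossing e∈F)))
    (λ _ f⊆Y _ f≡e → meets⇒¬⊆ (bipartition-swap B) (proj₁ (crossing e∈F)) (subst (_⊆ Y) f≡e f⊆Y))
    (λ _ f≢ f≡e → f≢ (cong (λ f → inside Vec.∷ (f ─ X)) f≡e))

  partD : Critical (suc (suc k)) G′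
  partD = critical⁺ G′ contract-uncolorable contract-noIsolated contract-delete

  properties : CutProperties (suc k) G F X Y
  properties = cut , (partA-X , λ φ → partA-Y φ , partA-Y-edges φ) , partB , partC , partD

-- Which side is monochromatic and which is rainbow

Oriented : ℕ → Hypergraph n → List (Subset n) → Subset n → Subset n → Set
Oriented {n} k G F X Y = (∀ {a : Fin n → Fin k} → ProperIn G X a → Single F X a) ×
                         (∀ {b : Fin n → Fin k} → ProperIn G Y b → Rainbow F Y b)

-- Each colouring is compared with a fixed partner on the other side: were it to fall under the
-- opposite alternative, that partner would be both single and rainbow.
orient : {G : Hypergraph n} {F : List (Subset n)} {X Y : Subset n}
         {a₀ b₀ : Fin n → Fin (suc (suc k))} →
         (∀ {e} → e ∈ₗ F → Meets e X × Meets e Y) →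
         (∀ {a b : Fin n → Fin (suc (suc k))} → ProperIn G X a → ProperIn G Y b →
            (Single F X a × Rainbow F Y b) ⊎ (Rainbow F X a × Single F Y b)) →
         ProperIn G X a₀ → ProperIn G Y b₀ →
         Oriented (suc (suc k)) G F X Y ⊎ Oriented (suc (suc k)) G F Y X
orient {n} {k} {G} {F} {X} {Y} {a₀} {b₀} crossing dichotomy a₀-proper b₀-proper
  with dichotomy {a₀} {b₀} a₀-proper b₀-proper
... | inj₁ (a₀-single , b₀-rainbow) = inj₁ ((λ {a} → single {a}) , (λ {b} → rainbow {b}))
  where
  single : ∀ {a} → ProperIn G X a → Single F X a
  single {a} a-proper with dichotomy {a} {b₀} a-proper b₀-proper
  ... | inj₁ (a-single , _)  = a-single
  ... | inj₂ (_ , b₀-single) = contradiction b₀-rainbow (single⇒¬rainbow b₀ (proj₂ ∘ crossing) b₀-single)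

  rainbow : ∀ {b} → ProperIn G Y b → Rainbow F Y b
  rainbow {b} b-proper with dichotomy {a₀} {b} a₀-proper b-proper
  ... | inj₁ (_ , b-rainbow)  = b-rainbow
  ... | inj₂ (a₀-rainbow , _) = contradiction a₀-rainbow (single⇒¬rainbow a₀ (proj₁ ∘ crossing) a₀-single)
... | inj₂ (a₀-rainbow , b₀-single) = inj₂ ((λ {b} → single {b}) , (λ {a} → rainbow {a}))
  where
  single : ∀ {b} → ProperIn G Y b → Single F Y b
  single {b} b-proper with dichotomy {a₀} {b} a₀-proper b-proper
  ... | inj₁ (a₀-single , _) = contradiction a₀-rainbow (single⇒¬rainbow a₀ (proj₁ ∘ crossing) a₀-single)
  ... | inj₂ (_ , b-single)  = b-single

  rainbow : ∀ {a} → ProperIn G X a → Rainbow F X a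
  rainbow {a} a-proper with dichotomy {a} {b₀} a-proper b₀-proper
  ... | inj₁ (_ , b₀-rainbow) = contradiction b₀-rainbow (single⇒¬rainbow b₀ (proj₂ ∘ crossing) b₀-single)
  ... | inj₂ (a-rainbow , _)  = a-rainbow

theorem12 : ∀ {n} (k : ℕ) → 2 ≤ k →
    (G : Hypergraph n) → Critical (suc k) G →
    (F : List (Subset n)) → Unique F → IsSeparating G F → length F ≤ k →
    length F ≡ k ×
    (∃[ X ] ∃[ Y ] Σ[ cut ∈ IsEdgeCut G X Y F ]
    ((∀ (φ : Coloring (G ⟦ X ⟧) k) → ∣ image φ (ends X F) ∣ ≡ 1) ×
    (∀ (φ : Coloring (G ⟦ Y ⟧) k) →
    ∣ image φ (ends Y F) ∣ ≡ k ×
    (∀ (i : Fin k) → ∃[ e ] e ∈ₗ F × image φ (e ∩ Y) ≡ ⁅ i ⁆))) ×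
    (∀ v → v ∈ ends Y F → ∃! _≡_ (λ e → e ∈ₗ F × v ∈ e)) ×
    ((2≤∣XF∣ : 2 ≤ ∣ ends X F ∣) →
    Critical (suc k) (addEdge (G ⟦ X ⟧) (ends X F) (ends-⊆ X F) 2≤∣XF∣)) ×
    Critical (suc k) (contract G cut))
theorem12 (suc zero) (s≤s ())
theorem12 {n} (suc (suc k)) 2≤k G crit F _ sep F≤k =
  let X , Y , B , cross = separating⇒bipartition sep in prove B cross
  where
  module _ {X Y} (B : Bipartition (V G) X Y)
           (cross : ∀ {e} → e ∈ₗ E G → Meets e X → Meets e Y → e ∈ₗ F) where
    private
      module S = Sides G B F (critical⇒uncolorable G crit) cross F≤k

    a₀ : Σ[ c ∈ (Fin n → Fin (suc (suc k))) ] ProperIn G X c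
    a₀ = critical⇒side G crit B

    b₀ : Σ[ c ∈ (Fin n → Fin (suc (suc k))) ] ProperIn G Y c
    b₀ = critical⇒side G crit (bipartition-swap B)

    crossing : ∀ {e} → e ∈ₗ F → Meets e X × Meets e Y
    crossing = proj₁ (S.dichotomy {proj₁ a₀} {proj₁ b₀} (proj₂ a₀) (proj₂ b₀) 2≤k)

    F⊆E : F ⊆ₗ E G
    F⊆E = IsSeparating.F⊆E sep

    cutProperties : Oriented (suc (suc k)) G F X Y ⊎ Oriented (suc (suc k)) G F Y X →
                    ∃[ X ] ∃[ Y ] CutProperties (suc (suc k)) G F X Y
    cutProperties (inj₁ (single , rainbow)) = X , Y ,
      Conclusion.properties G crit B F⊆E cross crossing
        (λ {c} → single {c}) (λ {c} → rainbow {c})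
    -- The rainbow side must be the second one, so the sides exchange names.
    cutProperties (inj₂ (single , rainbow)) = Y , X ,
      Conclusion.properties G crit (bipartition-swap B) F⊆E
        (λ e∈ meetsY meetsX → cross e∈ meetsX meetsY) (swap ∘ crossing)
        (λ {c} → single {c}) (λ {c} → rainbow {c})

    prove : length F ≡ suc (suc k) × ∃[ X ] ∃[ Y ] CutProperties (suc (suc k)) G F X Y
    prove = ≤-antisym F≤k (S.k≤∣F∣ {proj₁ a₀} {proj₁ b₀} (proj₂ a₀) (proj₂ b₀)) ,
      cutProperties (orient {G = G} {a₀ = proj₁ a₀} {proj₁ b₀} crossing
        (λ {a} {b} a-proper b-proper → proj₂ (S.dichotomy {a} {b} a-proper b-proper 2≤k))
        (proj₂ a₀) (proj₂ b₀))
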